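{- Let $n\ge 4$, let $\Sigma$ be a binary alphabet (i.e. $|\Sigma|=2$), let $G$ be a finite abelian group (written additively), let $f:\Sigma^*\to G$ be a monoid morphism, and let $h:\Sigma^*\to\Sigma^*$ be a morphism. Assume that: (D1) The frequency matrix of $h$ is non-singular. (D2) $f(h(\sigma))=0$ for each $\sigma\in\Sigma$. (D3) The set $A=f(\operatorname{Pref}(h))\subseteq G$ does not contain a non-trivial arithmetic progression of length $n+1$, i.e. $\operatorname{a-rk}(A)\le n$. (D4) $f$ is $h$-injective: for any positive integer $r$, if $f(v_1)=\cdots=f(v_r)$ with $v_i\in\operatorname{Pref}(h)\setminus h(\Sigma)$ for $i\in\{1,\dots,r\}$, then either $v_1=\cdots=v_r$ or $v_1'=\cdots=v_r'$, where $v_iv_i'=h(\sigma_{j_i})$ for some $\sigma_{j_i}\in\Sigma$. Let $G_h$ be the subgroup of $\mathbb{Z}^\Sigma$ generated by $\psi(h(\Sigma))$, let $\mathcal{P}=\psi(\operatorname{Pref}(h))$, and let $\overline{\mathcal{P}}$ be the image of $\mathcal{P}$ in $\mathbb{Z}^\Sigma/G_h$. Then $h$ satisfies: (O1) The frequency matrix of $h$ is non-singular. (O2) $\operatorname{a-rk}(\overline{\mathcal{P}})\le n$. (O3) For every $v\in\mathcal{P}\setminus(\psi(h(\Sigma))\cup\{0\})$, the equivalence class $[v]_{\mathcal{P}}=\{w\in\mathcal{P}: w-v\in G_h\}$ contains at most $2$ elements, and the Parikh vector of a non-empty proper prefix of $h$ (that is, of a non-empty proper prefix of $h(\sigma)$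 for some $\sigma\in\Sigma$) is not in the equivalence class of the zero vector $0\in\mathbb{Z}^\Sigma$ modulo $G_h$. Moreover, if $[v]_{\mathcal{P}}=\{v,w\}$ with $v\ne w$, then $v-w=\psi(h(p))-\psi(h(q))$ for unique $p,q\in\Sigma$ where $v\in\psi(\operatorname{Pref}(h(p)))$ and $w\in\psi(\operatorname{Pref}(h(q)))$.
   Context: $\Sigma^*$ is the free monoid of finite words over $\Sigma=\{\sigma_1,\dots,\sigma_m\}$ (here $m=2$), with empty word $\epsilon$; $\mathbb{Z}^\Sigma$ is the free $\mathbb{Z}$-module on $\Sigma$. A morphism $h:\Sigma^*\to\Sigma^*$ is a monoid homomorphism. The Parikh vector $\psi(u)\in\mathbb{N}^m\subset\mathbb{Z}^\Sigma$ of a word $u$ has $i$-th coordinate the number of occurrences of $\sigma_i$ in $u$. For a set of words $S$, $\psi(S)=\{\psi(u):u\in S\}$; $h(\Sigma)=\{h(\sigma):\sigma\in\Sigma\}$. The frequency matrix of $h$ is the $m\times m$ matrix whose $i$-th row is $\psi(h(\sigma_i))$. $\operatorname{Pref}(u)$ is the set of all prefixes of $u$ (including $\epsilon$ and $u$), and $\operatorname{Pref}(h)=\bigcup_{\sigma\in\Sigma}\operatorname{Pref}(h(\sigma))$. For an abelian group $G$ an arithmetic progression of length $k$ in $G$ is a sequence $a,a+d,\dots,a+(k-1)d$ with $a,d\in G$; it is trivial if $d=0$. For $A\subseteq G$, $\operatorname{a-rk}(A)$ is the length of a longest non-trivial arithmetic progression all of whose terms lie in $A$ (terms may repeat), and $\operatorname{a-rk}(A)=\infty$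 if these lengths are unbounded.
   Formalization: In (O3), "non-empty proper prefix of h" is taken to mean a non-empty element of Pref(h)∖h(Σ); proper prefixes of h(σ) equal to some h(τ) are excluded, since for them the clause always fails (e.g. h(a)=ba, h(b)=b, G=0). -}

module Defs where

open import Level using (Level; _⊔_; 0ℓ)
open import Algebra.Bundles using (AbelianGroup; RawMonoid)
import Algebra.Construct.Pointwise as Pointwise
import Algebra.Definitions.RawMonoid as RawMonoidDefs
import Algebra.Properties.AbelianGroup as AbelianGroupProperties
open import Data.Fin.Base using (Fin; zero; suc; toℕ; punchIn)
open import Data.Fin.Properties using (_≟_)
open import Data.Integer.Base as ℤ using (ℤ; +_; 0ℤ; 1ℤ; -1ℤ)
import Data.Integer.Properties as ℤₚ
open import Data.List.Base using (List; []; [_]; _++_; length; filter; ++-[]-rawMonoid)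
open import Data.List.Relation.Binary.Prefix.Heterogeneous using (Prefix)
open import Data.Nat.Base as ℕ using (ℕ; zero; suc)
open import Data.Product.Base using (∃; ∃₂; _×_; _,_)
open import Data.Product using (∃!)
open import Data.Sum.Base using (_⊎_)
open import Function.Base using (id)
open import Function.Bundles using (Inverse)
open import Relation.Binary.Core using (Rel)
open import Relation.Binary.PropositionalEquality as ≡ using (_≡_; _≢_)
import Relation.Binary.Reasoning.Setoid as SetoidReasoning
open import Relation.Nullary.Negation.Core using (¬_)
open import Relation.Unary using (Pred; _∈_; _∉_; _∖_; _≐_)

private
  variable
    a b c ℓ p : Level
    m : ℕ

------------------------------------------------------------------------
-- Sets up to a given equality

Image : {X : Set a} {Y : Set b} → Rel Y ℓ → (X → Y) → Pred X p → Pred Y (a ⊔ ℓ ⊔ p)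
Image _≈_ f S y = ∃ λ x → x ∈ S × f x ≈ y

HasAtMost : {X : Set a} → Rel X ℓ → ℕ → Pred X p → Set (a ⊔ ℓ ⊔ p)
HasAtMost {X = X} _≈_ k S =
  (g : Fin (suc k) → X) → (∀ i → g i ∈ S) → ∃₂ λ i j → i ≢ j × g i ≈ g j

------------------------------------------------------------------------
-- Abelian groups

Finite : AbelianGroup c ℓ → Set (c ⊔ ℓ)
Finite G = ∃ λ k → Inverse (AbelianGroup.setoid G) (≡.setoid (Fin k))

module _ (G : AbelianGroup c ℓ) where
  open AbelianGroup G
  open RawMonoidDefs rawMonoid using () renaming (_×_ to _·_)

  record NonTrivialAP (A : Pred Carrier p) (k : ℕ) : Set (c ⊔ ℓ ⊔ p) where
    field
      start      : Carrier
      difference : Carrier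
      nontrivial : ¬ (difference ≈ ε)
      terms      : (i : Fin k) → start ∙ (toℕ i · difference) ∈ A

  -- a-rk(A) ≤ n; a-rk itself takes values in ℕ ∪ {∞}, so it is only
  -- introduced through its upper bounds.
  a-rk≤ : Pred Carrier p → ℕ → Set (c ⊔ ℓ ⊔ p)
  a-rk≤ A n = ∀ k → NonTrivialAP A k → k ℕ.≤ n

  data Generated (S : Pred Carrier p) : Pred Carrier (c ⊔ ℓ ⊔ p) where
    gen  : ∀ {x} → x ∈ S → Generated S x
    ε∈   : Generated S ε
    _∙∈_ : ∀ {x y} → Generated S x → Generated S y → Generated S (x ∙ y)
    ⁻¹∈  : ∀ {x} → Generated S x → Generated S (x ⁻¹)
    resp : ∀ {x y} → x ≈ y → Generated S x → Generated S y

  -- The quotient by the subgroup generated by S: the same carrier, with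
  -- x and y identified when x - y lies in that subgroup.
  module _ (S : Pred Carrier p) where
    open AbelianGroupProperties G using (⁻¹-anti-homo‿-; ⁻¹-∙-comm)
    open SetoidReasoning setoid

    private
      infix 4 _~_
      _~_ : Rel Carrier (c ⊔ ℓ ⊔ p)
      x ~ y = Generated S (x - y)

      ≈⇒~ : ∀ {x y} → x ≈ y → x ~ y
      ≈⇒~ {x} {y} x≈y =
        resp (sym (trans (∙-congʳ x≈y) (inverseʳ y))) ε∈

      ~-sym : ∀ {x y} → x ~ y → y ~ x
      ~-sym {x} {y} q = resp (⁻¹-anti-homo‿- x y) (⁻¹∈ q)

      interchange : ∀ x y u v → (x ∙ y) ∙ (u ∙ v) ≈ (x ∙ u) ∙ (y ∙ v)
      interchange x y u v = begin
        (x ∙ y) ∙ (u ∙ v)  ≈⟨ assoc x y (u ∙ v) ⟩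
        x ∙ (y ∙ (u ∙ v))  ≈⟨ ∙-congˡ (assoc y u v) ⟨
        x ∙ ((y ∙ u) ∙ v)  ≈⟨ ∙-congˡ (∙-congʳ (comm y u)) ⟩
        x ∙ ((u ∙ y) ∙ v)  ≈⟨ ∙-congˡ (assoc u y v) ⟩
        x ∙ (u ∙ (y ∙ v))  ≈⟨ assoc x u (y ∙ v) ⟨
        (x ∙ u) ∙ (y ∙ v)  ∎

      ~-trans : ∀ {x y z} → x ~ y → y ~ z → x ~ z
      ~-trans {x} {y} {z} q r = resp lemma (q ∙∈ r)
        where
        lemma : (x - y) ∙ (y - z) ≈ x - z
        lemma = begin
          (x ∙ y ⁻¹) ∙ (y ∙ z ⁻¹)  ≈⟨ assoc x (y ⁻¹) (y ∙ z ⁻¹) ⟩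
          x ∙ (y ⁻¹ ∙ (y ∙ z ⁻¹))  ≈⟨ ∙-congˡ (assoc (y ⁻¹) y (z ⁻¹)) ⟨
          x ∙ ((y ⁻¹ ∙ y) ∙ z ⁻¹)  ≈⟨ ∙-congˡ (∙-congʳ (inverseˡ y)) ⟩
          x ∙ (ε ∙ z ⁻¹)           ≈⟨ ∙-congˡ (identityˡ (z ⁻¹)) ⟩
          x ∙ z ⁻¹                 ∎

      ~-∙-cong : ∀ {x y u v} → x ~ y → u ~ v → x ∙ u ~ y ∙ v
      ~-∙-cong {x} {y} {u} {v} q r = resp lemma (q ∙∈ r)
        where
        lemma : (x - y) ∙ (u - v) ≈ (x ∙ u) - (y ∙ v)
        lemma = trans (interchange x (y ⁻¹) u (v ⁻¹)) (∙-congˡ (⁻¹-∙-comm y v))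

      ~-⁻¹-cong : ∀ {x y} → x ~ y → x ⁻¹ ~ y ⁻¹
      ~-⁻¹-cong {x} {y} q = resp (sym (⁻¹-∙-comm x (y ⁻¹))) (⁻¹∈ q)

    _/⟨_⟩ : AbelianGroup c (c ⊔ ℓ ⊔ p)
    _/⟨_⟩ = record
      { Carrier = Carrier
      ; _≈_     = _~_
      ; _∙_     = _∙_
      ; ε       = ε
      ; _⁻¹     = _⁻¹
      ; isAbelianGroup = record
        { isGroup = record
          { isMonoid = record
            { isSemigroup = record
              { isMagma = record
                { isEquivalence = record
                  { refl  = ≈⇒~ refl
                  ; sym   = ~-sym
                  ; trans = ~-trans
                  }
                ; ∙-cong = ~-∙-cong
                }
              ; assoc = λ x y z → ≈⇒~ (assoc x y z)
              }
            ; identity = (λ x → ≈⇒~ (identityˡ x)) , (λ x → ≈⇒~ (identityʳ x))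
            }
          ; inverse = (λ x → ≈⇒~ (inverseˡ x)) , (λ x → ≈⇒~ (inverseʳ x))
          ; ⁻¹-cong = ~-⁻¹-cong
          }
        ; comm = λ x y → ≈⇒~ (comm x y)
        }
      }

------------------------------------------------------------------------
-- Words over Σ = Fin m and their Parikh vectors

Word : ℕ → Set
Word m = List (Fin m)

Word-rawMonoid : ℕ → RawMonoid 0ℓ 0ℓ
Word-rawMonoid m = ++-[]-rawMonoid (Fin m)

ℤ^_ : ℕ → AbelianGroup 0ℓ 0ℓ
ℤ^ m = Pointwise.abelianGroup (Fin m) ℤₚ.+-0-abelianGroup

module ℤ^ (m : ℕ) = AbelianGroup (ℤ^ m)

ψ : Word m → ℤ^.Carrier m
ψ u i = + length (filter (i ≟_) u)

ψ[_] : Pred (Word m) p → Pred (ℤ^.Carrier m) p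
ψ[_] {m = m} = Image (ℤ^._≈_ m) ψ

Pref : Word m → Pred (Word m) 0ℓ
Pref u v = Prefix _≡_ v u

-- Laplace expansion along the first row.
det : (Fin m → Fin m → ℤ) → ℤ
det {zero}  M = 1ℤ
det {suc m} M = sum λ j →
  (-1ℤ ℤ.^ toℕ j) ℤ.* (M zero j ℤ.* det λ i k → M (suc i) (punchIn j k))
  where open RawMonoidDefs ℤ.+-0-rawMonoid using (sum)

------------------------------------------------------------------------
-- Notions attached to a morphism h : Σ* → Σ*

module _ {m : ℕ} (h : Word m → Word m) where

  LetterImages : Pred (Word m) 0ℓ
  LetterImages u = ∃ λ σ → h [ σ ] ≡ u

  PrefMor : Pred (Word m) 0ℓ
  PrefMor u = ∃ λ σ → u ∈ Pref (h [ σ ])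

  -- Pref(h) ∖ h(Σ).  A prefix u ≠ h(σ) of h(σ) that happens to equal h(τ)
  -- for another letter τ is not counted as a proper prefix of h: its Parikh
  -- vector trivially lies in G_h, and neither non-singularity nor
  -- h-injectivity rules such a u out (h(σ₁) = σ₂σ₁, h(σ₂) = σ₂, f = 0).
  ProperPrefMor : Pred (Word m) 0ℓ
  ProperPrefMor = PrefMor ∖ LetterImages

  FrequencyMatrix : Fin m → Fin m → ℤ
  FrequencyMatrix i = ψ (h [ i ])

  NonSingular : Set
  NonSingular = det FrequencyMatrix ≢ 0ℤ

  G-gens : Pred (ℤ^.Carrier m) 0ℓ
  G-gens = ψ[ LetterImages ]

  ℤ^/G : AbelianGroup 0ℓ 0ℓ
  ℤ^/G = (ℤ^ m) /⟨ G-gens ⟩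

  𝒫 : Pred (ℤ^.Carrier m) 0ℓ
  𝒫 = ψ[ PrefMor ]

  𝒫̄ : Pred (AbelianGroup.Carrier ℤ^/G) 0ℓ
  𝒫̄ = Image (AbelianGroup._≈_ ℤ^/G) id 𝒫

  -- [ v ]𝒫
  Class : ℤ^.Carrier m → Pred (ℤ^.Carrier m) 0ℓ
  Class v w = w ∈ 𝒫 × Generated (ℤ^ m) G-gens (ℤ^._-_ m w v)

  module _ (G : AbelianGroup c ℓ) (f : Word m → AbelianGroup.Carrier G) where
    open AbelianGroup G

    -- The complements v′ i are data chosen along with the v i: a word that
    -- is a prefix of several h(σ) has several complements, and the
    -- condition is imposed for every choice.
    HInjective : Set ℓ
    HInjective =
      ∀ r → r ℕ.≥ 1 →
      (v v′ : Fin r → Word m) (j : Fin r → Fin m) →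
      (∀ i → v i ∈ PrefMor ∖ LetterImages) →
      (∀ i → v i ++ v′ i ≡ h [ j i ]) →
      (∀ i k → f (v i) ≈ f (v k)) →
      (∀ i k → v i ≡ v k) ⊎ (∀ i k → v′ i ≡ v′ k)

  module _ where
    open ℤ^ m

    ClassesHaveAtMostTwo : Set
    ClassesHaveAtMostTwo =
      ∀ v → v ∈ 𝒫 → v ∉ G-gens → ¬ (v ≈ ε) → HasAtMost _≈_ 2 (Class v)

    ProperPrefixesNotInZeroClass : Set
    ProperPrefixesNotInZeroClass =
      ∀ u → u ∈ ProperPrefMor → u ≢ [] →
      ¬ (AbelianGroup._≈_ ℤ^/G (ψ u) ε)

    TwoElementClasses : Set
    TwoElementClasses =
      ∀ v w → v ∈ 𝒫 → v ∉ G-gens → ¬ (v ≈ ε) → ¬ (v ≈ w) →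
      Class v ≐ (λ x → x ≈ v ⊎ x ≈ w) →
      ∃! _≡_ λ ((p , q) : Fin m × Fin m) →
        (v - w ≈ ψ (h [ p ]) - ψ (h [ q ])) ×
        (v ∈ ψ[ Pref (h [ p ]) ]) × (w ∈ ψ[ Pref (h [ q ]) ])

{-# OPTIONS --safe #-}

-- Since G is abelian, f factors as φ ∘ ψ for a homomorphism φ : ℤ^Σ → G, and φ
-- kills G_h by (D2); so words whose Parikh vectors agree modulo G_h have the same
-- value under f.  If two prefixes u and v of h have the same value, then, after
-- words of h(Σ) are replaced by the empty word, h-injectivity yields u = v or a
-- common complement, and in the latter case ψ(u) − ψ(v) is the difference of the
-- Parikh vectors of two images of letters.  Hence φ is injective on the image of 𝒫
-- modulo G_h, which transports arithmetic progressions to A.  Moreover a prefix with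
-- a given complement is determined by the letter whose image it begins, which bounds
-- the size of the classes.
module Submission where

open import Defs
open import Algebra.Bundles using (AbelianGroup; Monoid)
open import Algebra.Morphism.Structures using (IsMonoidHomomorphism)
import Algebra.Properties.AbelianGroup as AbelianGroupProperties
import Algebra.Properties.CommutativeMonoid.Sum as Sum
import Algebra.Properties.Monoid.Mult as Mult
open import Data.Empty using (⊥-elim)
open import Data.Fin.Base using (Fin; zero; suc; toℕ; punchIn; inject≤)
open import Data.Fin.Properties using (_≟_; any?; pigeonhole; punchInᵢ≢i; toℕ-inject≤; <⇒≢)
open import Data.Integer.Base as ℤ using (ℤ; +_; -[1+_]; 0ℤ; -1ℤ; _⊖_)
import Data.Integer.Properties as ℤₚ
open import Data.List.Base using ([]; _∷_; [_]; _++_; length; filter)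
open import Data.List.Properties using
  (++-cancelʳ; ++-identityˡ-unique; filter-++; filter-accept; filter-reject; length-++; ≡-dec)
open import Data.List.Relation.Binary.Prefix.Heterogeneous using ([]; _∷_)
open import Data.Nat.Base as ℕ using (ℕ; zero; suc; _≥_; z≤n; s≤s)
import Data.Nat.Properties as ℕₚ
open import Data.Product.Base using (∃; ∃₂; _×_; _,_; proj₁)
open import Data.Sum.Base using (_⊎_; inj₁; inj₂)
open import Function.Base using (_∘_)
open import Relation.Binary.PropositionalEquality as ≡ using (_≡_; _≢_)
import Relation.Binary.Reasoning.Setoid as SetoidReasoning
open import Relation.Nullary.Decidable.Core using (Dec; yes; no)
open import Relation.Nullary.Negation.Core using (¬_)
open import Relation.Unary using (Pred; _∈_; _∉_)

-- Words and Parikh vectors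

complement : ∀ {m} {u w : Word m} → w ∈ Pref u → ∃ λ w′ → w ++ w′ ≡ u
complement []             = _ , ≡.refl
complement (≡.refl ∷ pre) with complement pre
... | w′ , eq = w′ , ≡.cong (_ ∷_) eq

module _ {m : ℕ} where

  ψ-++ : ∀ (u v : Word m) i → ψ (u ++ v) i ≡ ψ u i ℤ.+ ψ v i
  ψ-++ u v i =
    ≡.cong +_ (≡.trans (≡.cong length (filter-++ (i ≟_) u v)) (length-++ (filter (i ≟_) u)))

  ψ-letter-≡ : ∀ (σ : Fin m) → ψ [ σ ] σ ≡ + 1
  ψ-letter-≡ σ = ≡.cong (λ w → + length w) (filter-accept (σ ≟_) ≡.refl)

  ψ-letter-≢ : ∀ {σ i : Fin m} → i ≢ σ → ψ [ σ ] i ≡ 0ℤ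
  ψ-letter-≢ i≢σ = ≡.cong (λ w → + length w) (filter-reject (_ ≟_) i≢σ)

-- Homomorphisms of abelian groups

module _ {c ℓ} (G : AbelianGroup c ℓ) where
  open AbelianGroup G
  open AbelianGroupProperties G
  open Mult monoid using (×-homo-+) renaming (_×_ to _·ℕ_)
  open Sum commutativeMonoid using (sum; sum-cong-≋; sum-replicate-zero; sum-remove; ∑-distrib-+)
  open SetoidReasoning setoid

  cancel-common : ∀ x y z → (x ∙ z) - (y ∙ z) ≈ x - y
  cancel-common x y z = begin
    (x ∙ z) ∙ (y ∙ z) ⁻¹       ≈⟨ ∙-congˡ (⁻¹-anti-homo-∙ y z) ⟩
    (x ∙ z) ∙ (z ⁻¹ ∙ y ⁻¹)    ≈⟨ assoc x z _ ⟩
    x ∙ (z ∙ (z ⁻¹ ∙ y ⁻¹))    ≈⟨ ∙-congˡ (\\-leftDividesˡ z (y ⁻¹)) ⟩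
    x - y                      ∎

  infixr 8 _·_
  _·_ : ℤ → Carrier → Carrier
  (+ n)    · x = n ·ℕ x
  -[1+ n ] · x = (suc n ·ℕ x) ⁻¹

  -- A sum of integers of opposite signs computes to `⊖`, so this is the mixed case of `·-homo-+`; a
  -- common successor contributes an `x` that cancels.
  ·-homo-⊖ : ∀ x m n → (m ⊖ n) · x ≈ m ·ℕ x - n ·ℕ x
  ·-homo-⊖ x zero    zero    = sym (inverseʳ ε)
  ·-homo-⊖ x zero    (suc n) = sym (identityˡ _)
  ·-homo-⊖ x (suc m) zero    = sym (trans (∙-congˡ ε⁻¹≈ε) (identityʳ _))
  ·-homo-⊖ x (suc m) (suc n) = begin
    (suc m ⊖ suc n) · x              ≡⟨ ≡.cong (_· x) (ℤₚ.[1+m]⊖[1+n]≡m⊖n m n) ⟩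
    (m ⊖ n) · x                      ≈⟨ ·-homo-⊖ x m n ⟩
    m ·ℕ x - n ·ℕ x                  ≈⟨ cancel-common _ _ x ⟨
    (m ·ℕ x ∙ x) - (n ·ℕ x ∙ x)      ≈⟨ ∙-cong (comm _ x) (⁻¹-cong (comm _ x)) ⟩
    (x ∙ m ·ℕ x) - (x ∙ n ·ℕ x)      ∎

  ·-homo-+ : ∀ x i j → (i ℤ.+ j) · x ≈ i · x ∙ j · x
  ·-homo-+ x (+ m)    (+ n)    = ×-homo-+ x m n
  ·-homo-+ x (+ m)    -[1+ n ] = ·-homo-⊖ x m (suc n)
  ·-homo-+ x -[1+ m ] (+ n)    = trans (·-homo-⊖ x n (suc m)) (comm _ _)
  ·-homo-+ x -[1+ m ] -[1+ n ] = begin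
    (suc (suc (m ℕ.+ n)) ·ℕ x) ⁻¹         ≡⟨ ≡.cong (λ k → (suc k ·ℕ x) ⁻¹) (ℕₚ.+-suc m n) ⟨
    ((suc m ℕ.+ suc n) ·ℕ x) ⁻¹           ≈⟨ ⁻¹-cong (×-homo-+ x (suc m) (suc n)) ⟩
    (suc m ·ℕ x ∙ suc n ·ℕ x) ⁻¹          ≈⟨ ⁻¹-∙-comm _ _ ⟨
    (suc m ·ℕ x) ⁻¹ ∙ (suc n ·ℕ x) ⁻¹     ∎

  module _ {m} (g : Fin m → Carrier) where

    -- The homomorphism from the free abelian group that extends `g`.
    combination : ℤ^.Carrier m → Carrier
    combination x = sum λ i → x i · g i

    combination-isMonoidHomomorphism :
      IsMonoidHomomorphism (ℤ^.rawMonoid m) rawMonoid combination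
    combination-isMonoidHomomorphism = record
      { isMagmaHomomorphism = record
        { isRelHomomorphism = record
          { cong = λ x≈y → sum-cong-≋ λ i → reflexive (≡.cong (_· g i) (x≈y i)) }
        ; homo = λ x y → trans
            (sum-cong-≋ λ i → ·-homo-+ (g i) (x i) (y i))
            (∑-distrib-+ (λ i → x i · g i) (λ i → y i · g i))
        }
      ; ε-homo = sum-replicate-zero m
      }

  -- `ψ [ σ ]` is the unit vector at `σ`, so only the summand split off by `sum-remove` survives.
  combination-letter : ∀ {m} (g : Fin m → Carrier) σ → combination g (ψ [ σ ]) ≈ g σ
  combination-letter {suc m} g σ = begin
    combination g (ψ [ σ ])
      ≈⟨ sum-remove {i = σ} (λ i → ψ [ σ ] i · g i) ⟩
    ψ [ σ ] σ · g σ ∙ sum (λ k → ψ [ σ ] (punchIn σ k) · g (punchIn σ k))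
      ≈⟨ ∙-cong (reflexive (≡.cong (_· g σ) (ψ-letter-≡ σ)))
                (sum-cong-≋ λ k → reflexive (≡.cong (_· g (punchIn σ k))
                                                    (ψ-letter-≢ (punchInᵢ≢i σ k)))) ⟩
    (g σ ∙ ε) ∙ sum {m} (λ _ → ε)
      ≈⟨ ∙-cong (identityʳ (g σ)) (sum-replicate-zero m) ⟩
    g σ ∙ ε
      ≈⟨ identityʳ (g σ) ⟩
    g σ ∎

  module _ {m} {f : Word m → Carrier}
           (f-hom : IsMonoidHomomorphism (Word-rawMonoid m) rawMonoid f) where
    private
      module ℤᵐ = ℤ^ m
      module f = IsMonoidHomomorphism f-hom

      φ : ℤᵐ.Carrier → Carrier
      φ = combination (λ τ → f [ τ ])

      module φ = IsMonoidHomomorphism (combination-isMonoidHomomorphism (λ τ → f [ τ ]))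

    -- Both sides are monoid morphisms in `u` and agree on letters by `combination-letter`.
    factors-through-ψ : ∀ u → combination (λ σ → f [ σ ]) (ψ u) ≈ f u
    factors-through-ψ []      = trans φ.ε-homo (sym f.ε-homo)
    factors-through-ψ (σ ∷ u) = begin
      φ (ψ (σ ∷ u))         ≈⟨ φ.⟦⟧-cong (ψ-++ [ σ ] u) ⟩
      φ (ψ [ σ ] ℤᵐ.∙ ψ u)  ≈⟨ φ.homo (ψ [ σ ]) (ψ u) ⟩
      φ (ψ [ σ ]) ∙ φ (ψ u) ≈⟨ ∙-cong (combination-letter (λ τ → f [ τ ]) σ) (factors-through-ψ u) ⟩
      f [ σ ] ∙ f u         ≈⟨ f.homo [ σ ] u ⟨
      f (σ ∷ u)             ∎

module _ {c₁ ℓ₁ c₂ ℓ₂} (M : Monoid c₁ ℓ₁) (N : Monoid c₂ ℓ₂)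
         {φ : Monoid.Carrier M → Monoid.Carrier N}
         (φ-hom : IsMonoidHomomorphism (Monoid.rawMonoid M) (Monoid.rawMonoid N) φ) where
  open IsMonoidHomomorphism φ-hom
  open Monoid N
  private
    module M× = Mult M
    module N× = Mult N

  homo-× : ∀ k x → φ (k M×.× x) ≈ k N×.× φ x
  homo-× zero    x = ε-homo
  homo-× (suc k) x = trans (homo x (k M×.× x)) (∙-congˡ (homo-× k x))

module _ {c₁ ℓ₁ c₂ ℓ₂} (A : AbelianGroup c₁ ℓ₁) (B : AbelianGroup c₂ ℓ₂)
         {φ : AbelianGroup.Carrier A → AbelianGroup.Carrier B}
         (φ-hom : IsMonoidHomomorphism (AbelianGroup.rawMonoid A) (AbelianGroup.rawMonoid B) φ) where
  open IsMonoidHomomorphism φ-hom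
  open AbelianGroup B
  open AbelianGroupProperties B
  private module A = AbelianGroup A

  homo-⁻¹ : ∀ x → φ (x A.⁻¹) ≈ φ x ⁻¹
  homo-⁻¹ x = inverseˡ-unique _ _
    (trans (sym (homo _ x)) (trans (⟦⟧-cong (A.inverseˡ x)) ε-homo))

  module _ {p} {S : Pred A.Carrier p} (φ-kills : ∀ {x} → x ∈ S → φ x ≈ ε) where

    kills-Generated : ∀ {x} → Generated A S x → φ x ≈ ε
    kills-Generated (gen x∈S)  = φ-kills x∈S
    kills-Generated ε∈         = ε-homo
    kills-Generated (x∈ ∙∈ y∈) =
      trans (homo _ _) (trans (∙-cong (kills-Generated x∈) (kills-Generated y∈)) (identityˡ ε))
    kills-Generated (⁻¹∈ x∈)   =
      trans (homo-⁻¹ _) (trans (⁻¹-cong (kills-Generated x∈)) ε⁻¹≈ε)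
    kills-Generated (resp x≈y x∈) = trans (⟦⟧-cong (A.sym x≈y)) (kills-Generated x∈)

    -- The quotient keeps the carrier, so `φ` itself is the induced map; only the congruence is new,
    -- and it holds because `x - y` is killed.
    quotient-isMonoidHomomorphism :
      IsMonoidHomomorphism (AbelianGroup.rawMonoid (A /⟨ S ⟩)) rawMonoid φ
    quotient-isMonoidHomomorphism = record
      { isMagmaHomomorphism = record
        { isRelHomomorphism = record
          { cong = λ {x} {y} x~y → x∙y⁻¹≈ε⇒x≈y _ _
              (trans (∙-congˡ (sym (homo-⁻¹ y))) (trans (sym (homo x _)) (kills-Generated x~y))) }
        ; homo = homo
        }
      ; ε-homo = ε-homo
      }

-- Determinants

private module ℤ-sum = Sum ℤₚ.+-0-commutativeMonoid

sum-zero : ∀ {m} (g : Fin m → ℤ) → (∀ i → g i ≡ 0ℤ) → ℤ-sum.sum g ≡ 0ℤ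
sum-zero {m} g g≡0 = ≡.trans (ℤ-sum.sum-cong-≗ g≡0) (ℤ-sum.sum-replicate-zero m)

-- In the expansion along the first row, either every entry factor vanishes or the zero row persists
-- in every minor, where induction applies.
det-zero-row : ∀ {m} (M : Fin m → Fin m → ℤ) i → (∀ k → M i k ≡ 0ℤ) → det M ≡ 0ℤ
det-zero-row {suc m} M i row≡0 = sum-zero _ (term i row≡0)
  where
  sign : Fin (suc m) → ℤ
  sign j = -1ℤ ℤ.^ toℕ j

  minor : Fin (suc m) → ℤ
  minor j = det λ i k → M (suc i) (punchIn j k)

  term : ∀ i → (∀ k → M i k ≡ 0ℤ) → ∀ j → sign j ℤ.* (M zero j ℤ.* minor j) ≡ 0ℤ
  term zero    row≡0 j = ≡.trans
    (≡.cong (λ x → sign j ℤ.* (x ℤ.* minor j)) (row≡0 j))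
    (ℤₚ.*-zeroʳ (sign j))
  term (suc i) row≡0 j = ≡.trans
    (≡.cong (λ x → sign j ℤ.* (M zero j ℤ.* x)) (det-zero-row _ i (row≡0 ∘ punchIn j)))
    (≡.trans (≡.cong (sign j ℤ.*_) (ℤₚ.*-zeroʳ (M zero j))) (ℤₚ.*-zeroʳ (sign j)))

-- An erased letter would give a zero row. Hence `[]` lies outside `h(Σ)`, and h-injectivity can be
-- applied to it.
nonSingular⇒nonErasing : ∀ {m} (h : Word m → Word m) → NonSingular h → [] ∉ LetterImages h
nonSingular⇒nonErasing h det≢0 (σ , hσ≡[]) =
  det≢0 (det-zero-row (FrequencyMatrix h) σ λ k → ≡.cong (λ w → ψ w k) hσ≡[])

-- Morphisms

module _ {c ℓ} {m}
         (G : AbelianGroup c ℓ)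
         (f : Word m → AbelianGroup.Carrier G)
         (f-hom : IsMonoidHomomorphism (Word-rawMonoid m) (AbelianGroup.rawMonoid G) f)
         (h : Word m → Word m)
         (f∘h≈ε : ∀ σ → AbelianGroup._≈_ G (f (h [ σ ])) (AbelianGroup.ε G))
         (nonErasing : [] ∉ LetterImages h)
         (h-inj : HInjective h G f)
         where
  open AbelianGroup G
  open SetoidReasoning setoid
  private
    module ℤᵐ = AbelianGroup (ℤ^ m)
    module Q = AbelianGroup (ℤ^/G h)

    φ : ℤᵐ.Carrier → Carrier
    φ = combination G (λ σ → f [ σ ])

    φ∘ψ≈f : ∀ u → φ (ψ u) ≈ f u
    φ∘ψ≈f = factors-through-ψ G f-hom

    φ-hom : IsMonoidHomomorphism ℤᵐ.rawMonoid rawMonoid φ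
    φ-hom = combination-isMonoidHomomorphism G (λ σ → f [ σ ])

    φ-kills : ∀ {x} → x ∈ G-gens h → φ x ≈ ε
    φ-kills (_ , (σ , ≡.refl) , ψhσ≈x) =
      trans (sym (φ.⟦⟧-cong ψhσ≈x)) (trans (φ∘ψ≈f _) (f∘h≈ε σ))
      where module φ = IsMonoidHomomorphism φ-hom

    φ̄-hom : IsMonoidHomomorphism Q.rawMonoid rawMonoid φ
    φ̄-hom = quotient-isMonoidHomomorphism (ℤ^ m) G φ-hom φ-kills

    φ-respects-Q≈ : ∀ x y → x Q.≈ y → φ x ≈ φ y
    φ-respects-Q≈ x y = IsMonoidHomomorphism.⟦⟧-cong φ̄-hom {x} {y}

  -- Congruence modulo G_h and values of `f`

  ≈⇒Q≈ : ∀ x y → x ℤᵐ.≈ y → x Q.≈ y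
  ≈⇒Q≈ x y x≈y = resp (ℤᵐ.sym (x≈y⇒x∙y⁻¹≈ε x≈y)) ε∈
    where open AbelianGroupProperties (ℤ^ m)

  f-respects-Q≈ : ∀ u v → ψ u Q.≈ ψ v → f u ≈ f v
  f-respects-Q≈ u v ψu~ψv = trans (sym (φ∘ψ≈f u)) (trans (φ-respects-Q≈ (ψ u) (ψ v) ψu~ψv) (φ∘ψ≈f v))

  letterImage-Q≈ε : ∀ σ → ψ (h [ σ ]) Q.≈ Q.ε
  letterImage-Q≈ε σ = resp (λ i → ≡.sym (ℤₚ.+-identityʳ (ψ (h [ σ ]) i)))
    (gen (_ , (σ , ≡.refl) , ℤᵐ.refl))

  letterImage? : ∀ u → Dec (u ∈ LetterImages h)
  letterImage? u = any? λ σ → ≡-dec _≟_ (h [ σ ]) u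

  -- Both images end in the same word, whose Parikh vector cancels in the difference.
  common-complement⇒difference : ∀ {u v u′ v′ p q} → u ++ u′ ≡ h [ p ] → v ++ v′ ≡ h [ q ] →
    u′ ≡ v′ → ψ u ℤᵐ.- ψ v ℤᵐ.≈ ψ (h [ p ]) ℤᵐ.- ψ (h [ q ])
  common-complement⇒difference {u} {v} {u′} u≡ v≡ ≡.refl = ℤᵐ.sym (ℤᵐ.trans
    (//-cong₂ (split u u≡) (split v v≡))
    (cancel-common (ℤ^ m) (ψ u) (ψ v) (ψ u′)))
    where
    open AbelianGroupProperties (ℤ^ m)
    split : ∀ w {x} → w ++ u′ ≡ x → ψ x ℤᵐ.≈ ψ w ℤᵐ.∙ ψ u′
    split w ≡.refl = ψ-++ w u′

  -- The case `r = 2` of `HInjective`, for words in place of families; the conclusion is read off at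
  -- the indices 0 and 1.
  h-injective₂ : ∀ {u v u′ v′ p q} → u ∈ ProperPrefMor h → v ∈ ProperPrefMor h →
    u ++ u′ ≡ h [ p ] → v ++ v′ ≡ h [ q ] → f u ≈ f v → u ≡ v ⊎ u′ ≡ v′
  h-injective₂ {u} {v} {u′} {v′} {p} {q} u∈ v∈ u≡ v≡ fu≈fv
    with h-inj 2 (s≤s z≤n)
           (λ { zero → u ; (suc _) → v }) (λ { zero → u′ ; (suc _) → v′ })
           (λ { zero → p ; (suc _) → q })
           (λ { zero → u∈ ; (suc _) → v∈ }) (λ { zero → u≡ ; (suc _) → v≡ })
           (λ { zero zero → refl ; zero (suc _) → fu≈fv
              ; (suc _) zero → sym fu≈fv ; (suc _) (suc _) → refl })
  ... | inj₁ eq = inj₁ (eq zero (suc zero))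
  ... | inj₂ eq = inj₂ (eq zero (suc zero))

  -- A converse to `f-respects-Q≈`: equal words are congruent, and a common complement makes
  -- `ψ u - ψ v` a difference of two generators of G_h.
  properPrefix-separated : ∀ {u v} → u ∈ ProperPrefMor h → v ∈ ProperPrefMor h →
    f u ≈ f v → ψ u Q.≈ ψ v
  properPrefix-separated {u} {v} u∈@((p , u⊑) , _) v∈@((q , v⊑) , _) fu≈fv
    with complement u⊑ | complement v⊑
  ... | _ , u≡ | _ , v≡ with h-injective₂ u∈ v∈ u≡ v≡ fu≈fv
  ... | inj₁ ≡.refl = Q.refl {ψ u}
  ... | inj₂ u′≡v′  = resp (ℤᵐ.sym (common-complement⇒difference u≡ v≡ u′≡v′))
    (gen (_ , (p , ≡.refl) , ℤᵐ.refl) ∙∈ ⁻¹∈ (gen (_ , (q , ≡.refl) , ℤᵐ.refl)))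

  -- `HInjective` does not speak of words of `h(Σ)`. Such a word is congruent to 0, so `[]` stands
  -- in for it; `nonErasing` makes `[]` proper.
  proper-representative : ∀ {u} → u ∈ PrefMor h → ∃ λ w → w ∈ ProperPrefMor h × ψ u Q.≈ ψ w
  proper-representative {u} u∈@(p , _) with letterImage? u
  ... | yes (σ , ≡.refl) = [] , ((p , []) , nonErasing) , letterImage-Q≈ε σ
  ... | no  u∉           = u , (u∈ , u∉) , Q.refl {ψ u}

  prefix-separated : ∀ {u v} → u ∈ PrefMor h → v ∈ PrefMor h → f u ≈ f v → ψ u Q.≈ ψ v
  prefix-separated {u} {v} u∈ v∈ fu≈fv
    with proper-representative u∈ | proper-representative v∈
  ... | w , w∈ , u~w | x , x∈ , v~x =
    Q.trans {ψ u} {ψ w} {ψ v} u~w (Q.trans {ψ w} {ψ x} {ψ v}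
      (properPrefix-separated w∈ x∈ fw≈fx) (Q.sym {ψ v} {ψ x} v~x))
    where
    fw≈fx : f w ≈ f x
    fw≈fx = trans (sym (f-respects-Q≈ u w u~w)) (trans fu≈fv (f-respects-Q≈ v x v~x))

  word-of : ∀ {x} → x ∈ 𝒫̄ h → ∃ λ u → u ∈ PrefMor h × ψ u Q.≈ x
  word-of {x} (y , (u , u∈ , ψu≈y) , y~x) = u , u∈ , Q.trans {ψ u} {y} {x} (≈⇒Q≈ (ψ u) y ψu≈y) y~x

  φ-image : ∀ {x} → x ∈ 𝒫̄ h → φ x ∈ Image _≈_ f (PrefMor h)
  φ-image {x} x∈ with word-of x∈
  ... | u , u∈ , ψu~x = u , u∈ , trans (sym (φ∘ψ≈f u)) (φ-respects-Q≈ (ψ u) x ψu~x)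

  -- Elements of `𝒫̄` are represented by words, on which `φ` agrees with `f`, so `prefix-separated`
  -- applies.
  φ-injective-on-𝒫̄ : ∀ {x y} → x ∈ 𝒫̄ h → y ∈ 𝒫̄ h → φ x ≈ φ y → x Q.≈ y
  φ-injective-on-𝒫̄ {x} {y} x∈ y∈ φx≈φy with word-of x∈ | word-of y∈
  ... | u , u∈ , ψu~x | v , v∈ , ψv~y =
    Q.trans {x} {ψ u} {y} (Q.sym {ψ u} {x} ψu~x)
      (Q.trans {ψ u} {ψ v} {y} (prefix-separated u∈ v∈ fu≈fv) ψv~y)
    where
    fu≈fv : f u ≈ f v
    fu≈fv = begin
      f u     ≈⟨ φ∘ψ≈f u ⟨
      φ (ψ u) ≈⟨ φ-respects-Q≈ (ψ u) x ψu~x ⟩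
      φ x     ≈⟨ φx≈φy ⟩
      φ y     ≈⟨ φ-respects-Q≈ (ψ v) y ψv~y ⟨
      φ (ψ v) ≈⟨ φ∘ψ≈f v ⟩
      f v     ∎

  -- Arithmetic progressions in `𝒫̄`

  open Mult Q.monoid using () renaming (_×_ to _·Q_)
  open Mult monoid using () renaming (_×_ to _·G_)

  -- A progression with more than `n` terms is cut to `n + 1` terms and mapped by `φ`. It stays
  -- non-trivial: if `φ d ≈ ε`, the first two terms have equal images, and injectivity of `φ` on
  -- `𝒫̄` makes them congruent, hence `d` zero in the quotient.
  a-rk-𝒫̄ : ∀ {n} → n ≥ 1 →
    ¬ NonTrivialAP G (Image _≈_ f (PrefMor h)) (suc n) → a-rk≤ (ℤ^/G h) (𝒫̄ h) n
  -- Matching `n` as a successor provides the second term, at index `suc zero` of `Fin (suc n)`.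
  a-rk-𝒫̄ {n@(suc _)} _ noAP k AP = ℕₚ.≮⇒≥ λ n<k → noAP (image n<k)
    where
    open NonTrivialAP AP renaming (start to s; difference to d)

    φ-term : ∀ i → φ (s Q.∙ i ·Q d) ≈ φ s ∙ i ·G φ d
    φ-term i = trans (IsMonoidHomomorphism.homo φ̄-hom s (i ·Q d))
      (∙-congˡ (homo-× Q.monoid monoid φ̄-hom i d))

    image : n ℕ.< k → NonTrivialAP G (Image _≈_ f (PrefMor h)) (suc n)
    image n<k = record
      { start      = φ s
      ; difference = φ d
      ; nontrivial = φd≉ε
      ; terms      = λ i → let u , u∈ , fu≈ = φ-image (term i) in u , u∈ , trans fu≈ (φ-term (toℕ i))
      }
      where
      term : ∀ (i : Fin (suc n)) → s Q.∙ toℕ i ·Q d ∈ 𝒫̄ h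
      term i = ≡.subst (λ j → s Q.∙ j ·Q d ∈ 𝒫̄ h) (toℕ-inject≤ i n<k) (terms (inject≤ i n<k))

      φd≉ε : ¬ (φ d ≈ ε)
      φd≉ε φd≈ε = nontrivial
        -- `1 ·Q d` unfolds to `d` plus the neutral element, whence `identityʳ`.
        (Q.trans {d} {1 ·Q d} {Q.ε} (Q.sym {1 ·Q d} {d} (Q.identityʳ d))
          (∙-cancelˡ s (1 ·Q d) Q.ε
            (φ-injective-on-𝒫̄ (term (suc zero)) (term zero) second≈first)))
        where
        open AbelianGroupProperties (ℤ^/G h) using (∙-cancelˡ)

        second≈first : φ (s Q.∙ 1 ·Q d) ≈ φ (s Q.∙ 0 ·Q d)
        second≈first = begin
          φ (s Q.∙ 1 ·Q d) ≈⟨ φ-term 1 ⟩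
          φ s ∙ 1 ·G φ d   ≈⟨ ∙-congˡ (trans (identityʳ (φ d)) φd≈ε) ⟩
          φ s ∙ ε          ≈⟨ φ-term 0 ⟨
          φ (s Q.∙ 0 ·Q d) ∎

  -- The zero class and the other classes of `𝒫`

  properPrefix-not-in-zero-class : ProperPrefixesNotInZeroClass h
  properPrefix-not-in-zero-class u u∈@((p , u⊑) , _) u≢[] ψu~0 with complement u⊑
  -- `u` is compared with `[]`, whose complement in `h [ p ]` is all of `h [ p ]`. Sharing this
  -- complement also forces `u` to be empty.
  ... | u′ , u≡ with h-injective₂ u∈ ((p , []) , nonErasing) u≡ ≡.refl (f-respects-Q≈ u [] ψu~0)
  ... | inj₁ u≡[]   = u≢[] u≡[]
  ... | inj₂ u′≡hp  = u≢[] (++-identityˡ-unique u (≡.trans u′≡hp (≡.sym u≡)))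

  -- Two prefixes of the same word with the same complement coincide, so both outcomes of
  -- `h-injective₂` give equality.
  properPrefix-determined : ∀ {σ u v} → u ∈ Pref (h [ σ ]) → v ∈ Pref (h [ σ ]) →
    u ∉ LetterImages h → v ∉ LetterImages h → f u ≈ f v → u ≡ v
  properPrefix-determined {σ} {u} u⊑ v⊑ u∉ v∉ fu≈fv with complement u⊑ | complement v⊑
  ... | u′ , u≡ | _ , v≡ with h-injective₂ ((σ , u⊑) , u∉) ((σ , v⊑) , v∉) u≡ v≡ fu≈fv
  ... | inj₁ u≡v    = u≡v
  ... | inj₂ ≡.refl = ++-cancelʳ u′ _ _ (≡.trans u≡ (≡.sym v≡))

  module _ {v} (v∈ : v ∈ 𝒫 h) (v∉gens : v ∉ G-gens h) (v≉ε : ¬ (v ℤᵐ.≈ ℤᵐ.ε)) where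

    -- The word behind `v` is a proper prefix because `v ∉ G-gens`, and non-empty because `v` is
    -- non-zero.
    class-nonzero : ¬ (v Q.≈ Q.ε)
    class-nonzero v~0 = let a , a∈ , ψa≈v = v∈ in properPrefix-not-in-zero-class a
      (a∈ , λ a∈hΣ → v∉gens (a , a∈hΣ , ψa≈v))
      (λ { ≡.refl → v≉ε (ℤᵐ.sym ψa≈v) })
      (Q.trans {ψ a} {v} {Q.ε} (≈⇒Q≈ (ψ a) v ψa≈v) v~0)

    -- The letter comes first so that `proj₁` serves as the label in the pigeonhole argument;
    -- membership in the class is recorded through the value of `f`.
    ClassWord : ℤᵐ.Carrier → Set ℓ
    ClassWord w = ∃₂ λ σ b →
      b ∈ Pref (h [ σ ]) × b ∉ LetterImages h × ψ b ℤᵐ.≈ w × f b ≈ φ v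

    -- Were `b` a letter image, `w` and hence `v` would be congruent to 0, against `class-nonzero`.
    class-word : ∀ {w} → w ∈ Class h v → ClassWord w
    class-word {w} ((b , (σ , b⊑) , ψb≈w) , w~v) = σ , b , b⊑ , b∉hΣ , ψb≈w , fb≈φv
      where
      b∉hΣ : b ∉ LetterImages h
      b∉hΣ (σ , ≡.refl) = class-nonzero (Q.trans {v} {w} {Q.ε} (Q.sym {w} {v} w~v)
        (Q.trans {w} {ψ b} {Q.ε} (≈⇒Q≈ w (ψ b) (ℤᵐ.sym ψb≈w)) (letterImage-Q≈ε σ)))

      fb≈φv : f b ≈ φ v
      fb≈φv = trans (sym (φ∘ψ≈f b))
        (φ-respects-Q≈ (ψ b) v (Q.trans {ψ b} {w} {v} (≈⇒Q≈ (ψ b) w ψb≈w) w~v))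

    -- Among `m + 1` members, two come from prefixes of the image of the same letter, and
    -- `properPrefix-determined` identifies these prefixes. The bound is thus the size of the
    -- alphabet.
    class-size : HasAtMost ℤᵐ._≈_ m (Class h v)
    class-size g g∈ =
      let i , k , i<k , same = pigeonhole (ℕₚ.n<1+n m) (λ i → proj₁ (class-word (g∈ i)))
      in i , k , <⇒≢ i<k , same-letter (class-word (g∈ i)) (class-word (g∈ k)) same
      where
      same-letter : ∀ {w x} ((σ , _) : ClassWord w) ((τ , _) : ClassWord x) → σ ≡ τ → w ℤᵐ.≈ x
      same-letter (_ , _ , a⊑ , a∉ , ψa≈w , fa≈) (_ , _ , b⊑ , b∉ , ψb≈x , fb≈) ≡.refl
        with properPrefix-determined a⊑ b⊑ a∉ b∉ (trans fa≈ (sym fb≈))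
      ... | ≡.refl = ℤᵐ.trans (ℤᵐ.sym ψa≈w) ψb≈x

    -- Distinct vectors rule out equal words, so h-injectivity leaves a common complement.
    class-difference : ∀ {w} → w ∈ Class h v → ¬ (v ℤᵐ.≈ w) → ∃₂ λ p q →
      (v ℤᵐ.- w ℤᵐ.≈ ψ (h [ p ]) ℤᵐ.- ψ (h [ q ])) ×
      (v ∈ ψ[ Pref (h [ p ]) ]) × (w ∈ ψ[ Pref (h [ q ]) ])
    class-difference w∈ v≉w
      with class-word (v∈ , Q.refl {v}) | class-word w∈
    ... | p , a , a⊑ , a∉ , ψa≈v , fa≈ | q , b , b⊑ , b∉ , ψb≈w , fb≈
      with complement a⊑ | complement b⊑
    ... | _ , a≡ | _ , b≡
      with h-injective₂ ((p , a⊑) , a∉) ((q , b⊑) , b∉) a≡ b≡ (trans fa≈ (sym fb≈))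
    ... | inj₁ ≡.refl = ⊥-elim (v≉w (ℤᵐ.trans (ℤᵐ.sym ψa≈v) ψb≈w))
    ... | inj₂ a′≡b′  = p , q ,
      ℤᵐ.trans (//-cong₂ (ℤᵐ.sym ψa≈v) (ℤᵐ.sym ψb≈w)) (common-complement⇒difference a≡ b≡ a′≡b′) ,
      (a , a⊑ , ψa≈v) , (b , b⊑ , ψb≈w)
      where open AbelianGroupProperties (ℤ^ m) using (//-cong₂)

-- Uniqueness of the pair of letters

i≡-i⇒i≡0 : ∀ {i} → i ≡ ℤ.- i → i ≡ 0ℤ
-- In the other cases `i` and `ℤ.- i` are built by different constructors.
i≡-i⇒i≡0 {+ zero} _ = ≡.refl

module _ {m : ℕ} where
  private module ℤᵐ = AbelianGroup (ℤ^ m)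
  open AbelianGroupProperties (ℤ^ m)

  -- A non-zero `x` forces `p ≢ q`. Over two letters the remaining pairs are swaps of each other,
  -- and a swap gives the opposite vector, whereas a vector of `ℤ^ m` equal to its opposite is zero.
  difference-letters-unique : ∀ (c : Fin 2 → ℤᵐ.Carrier) {x} → ¬ (x ℤᵐ.≈ ℤᵐ.ε) → ∀ {p q p′ q′} →
    x ℤᵐ.≈ c p ℤᵐ.- c q → x ℤᵐ.≈ c p′ ℤᵐ.- c q′ → (p , q) ≡ (p′ , q′)
  difference-letters-unique c {x} x≉ε {p} {q} {p′} {q′} = go p q p′ q′
    where
    equal-impossible : ∀ {A : Set} p → x ℤᵐ.≈ c p ℤᵐ.- c p → A
    equal-impossible p x≈ = ⊥-elim (x≉ε (ℤᵐ.trans x≈ (ℤᵐ.inverseʳ (c p))))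

    swap-impossible : ∀ {A : Set} p q → x ℤᵐ.≈ c p ℤᵐ.- c q → x ℤᵐ.≈ c q ℤᵐ.- c p → A
    swap-impossible p q x≈ x≈′ = ⊥-elim (x≉ε λ i → i≡-i⇒i≡0 (x≈x⁻¹ i))
      where
      x≈x⁻¹ : x ℤᵐ.≈ x ℤᵐ.⁻¹
      x≈x⁻¹ = ℤᵐ.trans x≈ (ℤᵐ.trans (ℤᵐ.sym (⁻¹-anti-homo‿- (c q) (c p))) (ℤᵐ.⁻¹-cong (ℤᵐ.sym x≈′)))

    go : ∀ p q p′ q′ → x ℤᵐ.≈ c p ℤᵐ.- c q → x ℤᵐ.≈ c p′ ℤᵐ.- c q′ → (p , q) ≡ (p′ , q′)
    go zero       zero       _          _          x≈ _   = equal-impossible zero x≈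
    go (suc zero) (suc zero) _          _          x≈ _   = equal-impossible (suc zero) x≈
    go _          _          zero       zero       _  x≈′ = equal-impossible zero x≈′
    go _          _          (suc zero) (suc zero) _  x≈′ = equal-impossible (suc zero) x≈′
    go zero       (suc zero) zero       (suc zero) _  _   = ≡.refl
    go (suc zero) zero       (suc zero) zero       _  _   = ≡.refl
    go zero       (suc zero) (suc zero) zero       x≈ x≈′ = swap-impossible zero (suc zero) x≈ x≈′
    go (suc zero) zero       zero       (suc zero) x≈ x≈′ = swap-impossible (suc zero) zero x≈ x≈′

theorem2p10 : ∀ {c ℓ} (n : ℕ) → n ≥ 4 →
    (G : AbelianGroup c ℓ) → Finite G →
    (f : Word 2 → AbelianGroup.Carrier G) →
    IsMonoidHomomorphism (Word-rawMonoid 2) (AbelianGroup.rawMonoid G) f →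
    (h : Word 2 → Word 2) →
    IsMonoidHomomorphism (Word-rawMonoid 2) (Word-rawMonoid 2) h →
    NonSingular h →
    (∀ (σ : Fin 2) → AbelianGroup._≈_ G (f (h [ σ ])) (AbelianGroup.ε G)) →
    ¬ NonTrivialAP G (Image (AbelianGroup._≈_ G) f (PrefMor h)) (suc n) →
    HInjective h G f →
    NonSingular h
    × a-rk≤ (ℤ^/G h) (𝒫̄ h) n
    × ClassesHaveAtMostTwo h
    × ProperPrefixesNotInZeroClass h
    × TwoElementClasses h
theorem2p10 n n≥4 G _ f f-hom h _ nonSingular f∘h≈ε noAP h-inj =
  nonSingular ,
  a-rk-𝒫̄ G f f-hom h f∘h≈ε nonErasing h-inj (ℕₚ.≤-trans (s≤s z≤n) n≥4) noAP ,
  (λ v v∈ v∉ v≉ε → class-size G f f-hom h f∘h≈ε nonErasing h-inj {v} v∈ v∉ v≉ε) ,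
  properPrefix-not-in-zero-class G f f-hom h f∘h≈ε nonErasing h-inj ,
  twoElementClasses
  where
  nonErasing : [] ∉ LetterImages h
  nonErasing = nonSingular⇒nonErasing h nonSingular

  open AbelianGroupProperties (ℤ^ 2) using (x∙y⁻¹≈ε⇒x≈y)

  twoElementClasses : TwoElementClasses h
  twoElementClasses v w v∈ v∉ v≉ε v≉w (_ , ⊆Class) =
    -- `⊆Class` is applied at `w` itself to place `w` in the class of `v`.
    let p , q , v-w≈ , v⊑ , w⊑ = class-difference G f f-hom h f∘h≈ε nonErasing h-inj
          {v} v∈ v∉ v≉ε {w} (⊆Class {w} (inj₂ (λ _ → ≡.refl))) v≉w
    in (p , q) , (v-w≈ , v⊑ , w⊑) ,
       -- The difference `v - w` determines the pair, being non-zero because `v` and `w` differ.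
       λ (v-w≈′ , _) → difference-letters-unique (λ σ → ψ (h [ σ ]))
         (v≉w ∘ x∙y⁻¹≈ε⇒x≈y v w) v-w≈ v-w≈′
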